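{- There is an infinite computably discrete computably Quasi-Polish space $\mathbf{X}$ such that every computable $f:\mathbf{X}\to\mathbb{N}$ is constant.
   Context: A represented space $\mathbf{X}=(X,\delta_{\mathbf{X}})$ is a set $X$ with a partial surjection $\delta_{\mathbf{X}}:\subseteq\mathbb{N}^{\mathbb{N}}\to X$; any $p$ with $\delta_{\mathbf X}(p)=x$ is a name of $x$. A realiser of a map $f:\mathbf{X}\to\mathbf{Y}$ is a partial map $R_f:\subseteq\mathbb{N}^{\mathbb{N}}\to\mathbb{N}^{\mathbb{N}}$ sending every name of every $x\in X$ to a name of $f(x)$; $f$ is computable (continuously realisable) if it has a computable (continuous) realiser. A computable isomorphism is a computable bijection with computable inverse. $\mathbb{N}$ is represented by $\delta_{\mathbb N}(p)=p(0)$. $\mathbf{Y}^{\mathbf{X}}$ is the represented space of total continuously realisable functions; a name of $f$ is a $p\in\mathbb N^{\mathbb N}$ coding a realiser of $f$, with $p(0)$ the index of a Turing machine using the oracle $n\mapsto p(n+1)$. In the product $\mathbf{X}\times\mathbf{Y}$, $p$ names $(x,y)$ iff $n\mapsto p(2n)$ names $x$ and $n\mapsto p(2n+1)$ names $y$. Sierpinski space $\mathbb{S}=\{\top,\bot\}$ is represented so that $0^\omega$ names $\bot$ and every other sequence names $\top$. The space $\mathcal{O}(\mathbf{X})$ of open sets is $\mathbb{S}^{\mathbf{X}}$, identifying $U$ with its characteristic function ($x\mapsto\top$ iff $x\in U$); $U$ is computably open if it is a computable point of $\mathcal O(\mathbf X)$ (i.e. has a computable name). $\mathbf{X}$ is computably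 discrete if the diagonal of $\mathbf X\times\mathbf X$ is computably open, i.e. equality is semidecidable. $\mathbf{X}$ is computably overt if non-emptiness of a given $U\in\mathcal{O}(\mathbf{X})$ is semidecidable, i.e. $\{U\in\mathcal O(\mathbf X)\mid U\neq\emptyset\}$ is computably open in $\mathcal{O}(\mathbf{X})$. For a transitive relation $\ll$ on $\mathbb{N}$, an ideal is a non-empty $I\subseteq\mathbb{N}$ such that $x\ll y\in I$ implies $x\in I$, and for all $x,y\in I$ there is $z\in I$ with $x\ll z$ and $y\ll z$. $\mathbf{I}(\ll)$ is the represented space of ideals, where $p$ names $I$ iff $I=\{p(k)\mid k\in\mathbb{N}\}$. A represented space is precomputably Quasi-Polish if it is computably isomorphic to $\mathbf{I}(\ll)$ for some computably enumerable transitive relation $\ll$ on $\mathbb N$; it is computably Quasi-Polish if it is moreover computably overt. -}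

module Defs where

open import Level using (Level; _⊔_; 0ℓ) renaming (suc to lsuc)
open import Data.Nat using (ℕ; zero; suc; _+_; _*_; _<_; _≤_; z≤n; s≤s)
open import Data.Nat.Properties
  using (+-suc; +-identityʳ; <-cmp; m≤m+n; m≤n+m; ≤-trans)
open import Data.Product using (Σ; ∃-syntax; _×_; _,_; proj₁; proj₂)
open import Data.Product.Relation.Binary.Pointwise.NonDependent using (_×ₛ_)
open import Function.Base using (_∘_)
open import Function.Bundles using (Func; Injection; Inverse; _⇔_; _⟶ₛ_; mk⇔)
open import Function.Properties.Inverse using (toFunction; fromFunction)
import Function.Properties.Equivalence as ⇔
import Function.Relation.Binary.Setoid.Equality as FuncEq
open import Relation.Binary.Definitions using (Transitive; tri<; tri≈; tri>)
open import Relation.Binary.Bundles using (Setoid)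
import Relation.Binary.Construct.On as On
open import Relation.Binary.PropositionalEquality
  using (_≡_; _≢_; _≗_; refl; sym; trans; cong; cong₂; setoid)

-- Cantor pairing: `unpair` enumerates ℕ × ℕ along antidiagonals,
-- (0,s), (1,s-1), …, (s,0), (0,s+1), …
triangle : ℕ → ℕ
triangle zero    = 0
triangle (suc n) = suc n + triangle n

pair : ℕ → ℕ → ℕ
pair a b = a + triangle (a + b)

next : ℕ × ℕ → ℕ × ℕ
next (a , zero)  = 0 , suc a
next (a , suc b) = suc a , b

unpair : ℕ → ℕ × ℕ
unpair zero    = 0 , 0
unpair (suc n) = next (unpair n)

unpair-pair : ∀ a b → unpair (pair a b) ≡ (a , b)
unpair-pair a b = diagonal (a + b) a b refl
  where
  diagonal : ∀ s a b → a + b ≡ s → unpair (pair a b) ≡ (a , b)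
  diagonal zero zero zero refl = refl
  diagonal (suc s) zero (suc b) refl =
    trans (cong (λ t → next (unpair (b + triangle t))) (sym (+-identityʳ b)))
          (cong next (diagonal s b zero (+-identityʳ b)))
  diagonal s (suc a) b eq =
    trans (cong (λ t → next (unpair (a + triangle t))) (sym (+-suc a b)))
          (cong next (diagonal s a (suc b) (trans (+-suc a b) eq)))

-- Oracle computation.  A program denotes, relative to an oracle o : ℕ → ℕ, a
-- partial function on ℕ; these are exactly the functions that are partial
-- recursive in o, i.e. computable by a Turing machine with oracle o.  `prec c d`
-- takes ⟨a , m⟩ and recurses on m; `μ c` searches for the least root of c⟨n , –⟩.

data Code : Set where
  zero succ left right query : Code
  pairing comp prec : Code → Code → Code
  μ : Code → Code

-- Gödel numbering; `encode c` plays the role of the index of a machine.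
encode : Code → ℕ
encode zero          = pair 0 0
encode succ          = pair 1 0
encode left          = pair 2 0
encode right         = pair 3 0
encode query         = pair 4 0
encode (pairing c d) = pair 5 (pair (encode c) (encode d))
encode (comp c d)    = pair 6 (pair (encode c) (encode d))
encode (prec c d)    = pair 7 (pair (encode c) (encode d))
encode (μ c)         = pair 8 (encode c)

Sequence : Set
Sequence = ℕ → ℕ

PrimRec : (ℕ → ℕ → Set) → (ℕ → ℕ → Set) → ℕ → ℕ → ℕ → Set
PrimRec F G a zero    v = F a v
PrimRec F G a (suc m) v = ∃[ u ] PrimRec F G a m u × G (pair a (pair m u)) v

-- ⟦ c ⟧ o n v : with oracle o, program c halts on input n with output v.
⟦_⟧ : Code → Sequence → ℕ → ℕ → Set
⟦ zero ⟧        o n v = v ≡ 0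
⟦ succ ⟧        o n v = v ≡ suc n
⟦ left ⟧        o n v = v ≡ proj₁ (unpair n)
⟦ right ⟧       o n v = v ≡ proj₂ (unpair n)
⟦ query ⟧       o n v = v ≡ o n
⟦ pairing c d ⟧ o n v = ∃[ a ] ∃[ b ] ⟦ c ⟧ o n a × ⟦ d ⟧ o n b × v ≡ pair a b
⟦ comp c d ⟧    o n v = ∃[ m ] ⟦ d ⟧ o n m × ⟦ c ⟧ o m v
⟦ prec c d ⟧    o n v =
  PrimRec (⟦ c ⟧ o) (⟦ d ⟧ o) (proj₁ (unpair n)) (proj₂ (unpair n)) v
⟦ μ c ⟧         o n v =
  ⟦ c ⟧ o (pair n v) 0 × (∀ m → m < v → ∃[ w ] ⟦ c ⟧ o (pair n m) (suc w))

-- The graph of the partial map on Baire space computed by c.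
⟦_⟧ᴮ : Code → Sequence → Sequence → Set
⟦ c ⟧ᴮ o q = ∀ n → ⟦ c ⟧ o n (q n)

0ω : Sequence
0ω _ = 0

ComputableSequence : Sequence → Set
ComputableSequence p = ∃[ c ] ⟦ c ⟧ᴮ 0ω p

-- c.e. relations as domains of partial computable functions
ComputablyEnumerable : (ℕ → ℕ → Set) → Set
ComputablyEnumerable _≪_ =
  ∃[ c ] (∀ x y → (x ≪ y) ⇔ (∃[ v ] ⟦ c ⟧ 0ω (pair x y) v))

private
  ≡-tri : ∀ {m n} {A : Set} → (m < n → A) → (m ≡ n → A) → (n < m → A) → A
  ≡-tri {m} {n} f g h with <-cmp m n
  ... | tri< p _ _ = f p
  ... | tri≈ _ p _ = g p
  ... | tri> _ _ p = h p

  PrimRec-functional : ∀ {F G : ℕ → ℕ → Set}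
    → (∀ {n v w} → F n v → F n w → v ≡ w)
    → (∀ {n v w} → G n v → G n w → v ≡ w)
    → ∀ a m {v w} → PrimRec F G a m v → PrimRec F G a m w → v ≡ w
  PrimRec-functional f g a zero x y = f x y
  PrimRec-functional f g a (suc m) (_ , x , s) (_ , y , t)
    with refl ← PrimRec-functional f g a m x y = g s t

⟦⟧-functional : ∀ c {o n v w} → ⟦ c ⟧ o n v → ⟦ c ⟧ o n w → v ≡ w
⟦⟧-functional zero  refl refl = refl
⟦⟧-functional succ  refl refl = refl
⟦⟧-functional left  refl refl = refl
⟦⟧-functional right refl refl = refl
⟦⟧-functional query refl refl = refl
⟦⟧-functional (pairing c d) (_ , _ , s , t , refl) (_ , _ , s′ , t′ , refl) =
  cong₂ pair (⟦⟧-functional c s s′) (⟦⟧-functional d t t′)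
⟦⟧-functional (comp c d) (_ , s , t) (_ , s′ , t′)
  with refl ← ⟦⟧-functional d s s′ = ⟦⟧-functional c t t′
⟦⟧-functional (prec c d) {n = n} =
  PrimRec-functional (⟦⟧-functional c) (⟦⟧-functional d)
    (proj₁ (unpair n)) (proj₂ (unpair n))
⟦⟧-functional (μ c) {v = v} {w} (s , below) (s′ , below′) = ≡-tri
  (λ v<w → case′ (⟦⟧-functional c s (proj₂ (below′ v v<w))))
  (λ v≡w → v≡w)
  (λ w<v → case′ (⟦⟧-functional c s′ (proj₂ (below w w<v))))
  where
  case′ : ∀ {k} → 0 ≡ suc k → v ≡ w
  case′ ()

⟦⟧-cong-oracle : ∀ c {o o′} → o ≗ o′ → ∀ {n v} → ⟦ c ⟧ o n v → ⟦ c ⟧ o′ n v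
⟦⟧-cong-oracle zero  e s = s
⟦⟧-cong-oracle succ  e s = s
⟦⟧-cong-oracle left  e s = s
⟦⟧-cong-oracle right e s = s
⟦⟧-cong-oracle query e {n} s = trans s (e n)
⟦⟧-cong-oracle (pairing c d) e (a , b , s , t , r) =
  a , b , ⟦⟧-cong-oracle c e s , ⟦⟧-cong-oracle d e t , r
⟦⟧-cong-oracle (comp c d) e (m , s , t) =
  m , ⟦⟧-cong-oracle d e s , ⟦⟧-cong-oracle c e t
⟦⟧-cong-oracle (prec c d) {o} {o′} e {n} = go (proj₂ (unpair n))
  where
  go : ∀ m {v} → PrimRec (⟦ c ⟧ o) (⟦ d ⟧ o) (proj₁ (unpair n)) m v
               → PrimRec (⟦ c ⟧ o′) (⟦ d ⟧ o′) (proj₁ (unpair n)) m v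
  go zero    s           = ⟦⟧-cong-oracle c e s
  go (suc m) (u , s , t) = u , go m s , ⟦⟧-cong-oracle d e t
⟦⟧-cong-oracle (μ c) e (s , below) =
  ⟦⟧-cong-oracle c e s ,
  λ m m<v → proj₁ (below m m<v) , ⟦⟧-cong-oracle c e (proj₂ (below m m<v))

private
  size : Code → ℕ
  size (pairing c d) = suc (size c + size d)
  size (comp c d)    = suc (size c + size d)
  size (prec c d)    = suc (size c + size d)
  size (μ c)         = suc (size c)
  size _             = 1

  binary : (Code → Code → Code) → (ℕ → Code) → ℕ × ℕ → Code
  binary k dec (a , b) = k (dec a) (dec b)

  decode : ℕ → ℕ → Code
  decode zero    _ = zero
  decode (suc k) n with unpair n
  ... | 0 , _ = zero
  ... | 1 , _ = succ
  ... | 2 , _ = left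
  ... | 3 , _ = right
  ... | 4 , _ = query
  ... | 5 , r = binary pairing (decode k) (unpair r)
  ... | 6 , r = binary comp (decode k) (unpair r)
  ... | 7 , r = binary prec (decode k) (unpair r)
  ... | _ , r = μ (decode k r)

  decode-encode : ∀ k c → size c ≤ k → decode k (encode c) ≡ c
  decode-encode (suc k) zero  _ = refl
  decode-encode (suc k) succ  _ = refl
  decode-encode (suc k) left  _ = refl
  decode-encode (suc k) right _ = refl
  decode-encode (suc k) query _ = refl
  decode-encode (suc k) (pairing c d) (s≤s h)
    rewrite unpair-pair 5 (pair (encode c) (encode d))
          | unpair-pair (encode c) (encode d)
    = cong₂ pairing (decode-encode k c (≤-trans (m≤m+n _ _) h))
                    (decode-encode k d (≤-trans (m≤n+m _ (size c)) h))
  decode-encode (suc k) (comp c d) (s≤s h)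
    rewrite unpair-pair 6 (pair (encode c) (encode d))
          | unpair-pair (encode c) (encode d)
    = cong₂ comp (decode-encode k c (≤-trans (m≤m+n _ _) h))
                 (decode-encode k d (≤-trans (m≤n+m _ (size c)) h))
  decode-encode (suc k) (prec c d) (s≤s h)
    rewrite unpair-pair 7 (pair (encode c) (encode d))
          | unpair-pair (encode c) (encode d)
    = cong₂ prec (decode-encode k c (≤-trans (m≤m+n _ _) h))
                 (decode-encode k d (≤-trans (m≤n+m _ (size c)) h))
  decode-encode (suc k) (μ c) (s≤s h)
    rewrite unpair-pair 8 (encode c)
    = cong μ (decode-encode k c h)

encode-injective : ∀ {c d} → encode c ≡ encode d → c ≡ d
encode-injective {c} {d} eq =
  trans (sym (decode-encode (size c + size d) c (m≤m+n _ _)))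
  (trans (cong (decode (size c + size d)) eq)
         (decode-encode (size c + size d) d (m≤n+m _ (size c))))

-- Sets are setoids, and the partial surjection δ is given by its graph:
-- p ⊩ x means δ(p) = x.
record RepresentedSpace (c ℓ r : Level) : Set (lsuc (c ⊔ ℓ ⊔ r)) where
  field
    points : Setoid c ℓ
  open Setoid points public using (Carrier; _≈_)
  field
    _⊩_        : Sequence → Carrier → Set r
    ⊩-resp     : ∀ {p q x y} → p ≗ q → x ≈ y → p ⊩ x → q ⊩ y
    functional : ∀ {p x y} → p ⊩ x → p ⊩ y → x ≈ y
    surjective : ∀ x → ∃[ p ] p ⊩ x

open RepresentedSpace using (points; Carrier; surjective)

_∋_⊩_ : ∀ {c ℓ r} (X : RepresentedSpace c ℓ r) → Sequence → Carrier X → Set r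
X ∋ p ⊩ x = RepresentedSpace._⊩_ X p x

-- The space of all elements of A that have a name.  For the ideals and for
-- Sierpinski space below, excluded middle provides every element with a name,
-- so classically nothing is removed; for function spaces, having a name is what
-- continuous realisability means.
nameable : ∀ {c ℓ r} (A : Setoid c ℓ) (_⊩_ : Sequence → Setoid.Carrier A → Set r)
  → (∀ {p q x y} → p ≗ q → Setoid._≈_ A x y → p ⊩ x → q ⊩ y)
  → (∀ {p x y} → p ⊩ x → p ⊩ y → Setoid._≈_ A x y)
  → RepresentedSpace (c ⊔ r) ℓ r
nameable A _⊩_ resp fun = record
  { points     = On.setoid {B = ∃[ x ] ∃[ p ] p ⊩ x} A proj₁
  ; _⊩_        = λ p x → p ⊩ proj₁ x
  ; ⊩-resp     = resp
  ; functional = fun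
  ; surjective = proj₂
  }

ComputablePoint : ∀ {c ℓ r} (X : RepresentedSpace c ℓ r) → Carrier X → Set r
ComputablePoint X x = ∃[ p ] ComputableSequence p × (X ∋ p ⊩ x)

module _ {c ℓ r c′ ℓ′ r′} (X : RepresentedSpace c ℓ r) (Y : RepresentedSpace c′ ℓ′ r′) where

  Map : Set (c ⊔ ℓ ⊔ c′ ⊔ ℓ′)
  Map = points X ⟶ₛ points Y

  -- R is the graph of a partial map on Baire space.
  Realises : (Sequence → Sequence → Set) → Map → Set (c ⊔ r ⊔ r′)
  Realises R f = ∀ x p → X ∋ p ⊩ x → ∃[ q ] R p q × (Y ∋ q ⊩ Func.to f x)

  Computable : Map → Set (c ⊔ r ⊔ r′)
  Computable f = ∃[ c ] Realises ⟦ c ⟧ᴮ f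

ComputablyIsomorphic : ∀ {c ℓ r c′ ℓ′ r′} →
  RepresentedSpace c ℓ r → RepresentedSpace c′ ℓ′ r′ →
  Set (c ⊔ ℓ ⊔ r ⊔ c′ ⊔ ℓ′ ⊔ r′)
ComputablyIsomorphic X Y =
  Σ (Inverse (points X) (points Y)) λ φ →
    Computable X Y (toFunction φ) × Computable Y X (fromFunction φ)

ℕᴿ : RepresentedSpace 0ℓ 0ℓ 0ℓ
ℕᴿ = record
  { points     = setoid ℕ
  ; _⊩_        = λ p n → p 0 ≡ n
  ; ⊩-resp     = λ { p≗q refl h → trans (sym (p≗q 0)) h }
  ; functional = λ h h′ → trans (sym h) h′
  ; surjective = λ n → (λ _ → n) , refl
  }

evens odds : Sequence → Sequence
evens p n = p (2 * n)
odds  p n = p (suc (2 * n))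

interleave : Sequence → Sequence → Sequence
interleave p q zero    = p 0
interleave p q (suc n) = interleave q (p ∘ suc) n

evens-interleave : ∀ p q → evens (interleave p q) ≗ p
evens-interleave p q zero    = refl
evens-interleave p q (suc n)
  rewrite +-suc n (n + 0) = evens-interleave (p ∘ suc) (q ∘ suc) n

odds-interleave : ∀ p q → odds (interleave p q) ≗ q
odds-interleave p q = evens-interleave q (p ∘ suc)

interleave-cong : ∀ {p p′ q q′} → p ≗ p′ → q ≗ q′ → interleave p q ≗ interleave p′ q′
interleave-cong e f zero    = e 0
interleave-cong e f (suc n) = interleave-cong f (e ∘ suc) n

infixr 2 _×ᴿ_

_×ᴿ_ : ∀ {c ℓ r c′ ℓ′ r′} →
  RepresentedSpace c ℓ r → RepresentedSpace c′ ℓ′ r′ →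
  RepresentedSpace (c ⊔ c′) (ℓ ⊔ ℓ′) (r ⊔ r′)
X ×ᴿ Y = record
  { points     = points X ×ₛ points Y
  ; _⊩_        = λ p (x , y) → (X ∋ evens p ⊩ x) × (Y ∋ odds p ⊩ y)
  ; ⊩-resp     = λ e (x≈ , y≈) (h , k) →
      X.⊩-resp (λ n → e (2 * n)) x≈ h , Y.⊩-resp (λ n → e (suc (2 * n))) y≈ k
  ; functional = λ (h , k) (h′ , k′) → X.functional h h′ , Y.functional k k′
  ; surjective = λ (x , y) →
      let p , h = surjective X x
          q , k = surjective Y y
      in interleave p q
       , X.⊩-resp (λ n → sym (evens-interleave p q n)) X.refl h
       , Y.⊩-resp (λ n → sym (odds-interleave p q n)) Y.refl k
  }
  where
  module X where
    open RepresentedSpace X public using (⊩-resp; functional)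
    open Setoid (points X) public using (refl)
  module Y where
    open RepresentedSpace Y public using (⊩-resp; functional)
    open Setoid (points Y) public using (refl)

-- p(0) is the index of a machine that, with the parameter n ↦ p(n+1) and a name
-- of x joined into a single oracle, computes a name of f(x).
Codes : ∀ {c ℓ r c′ ℓ′ r′} (X : RepresentedSpace c ℓ r) (Y : RepresentedSpace c′ ℓ′ r′) →
  Sequence → Map X Y → Set (c ⊔ r ⊔ r′)
Codes X Y p f = ∃[ c ] p 0 ≡ encode c
  × Realises X Y (λ x y → ⟦ c ⟧ᴮ (interleave (p ∘ suc) x) y) f

infixr 3 _⇒ᴿ_

_⇒ᴿ_ : ∀ {c ℓ r c′ ℓ′ r′} →
  RepresentedSpace c ℓ r → RepresentedSpace c′ ℓ′ r′ →
  RepresentedSpace (c ⊔ ℓ ⊔ r ⊔ c′ ⊔ ℓ′ ⊔ r′) (c ⊔ ℓ′) (c ⊔ r ⊔ r′)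
X ⇒ᴿ Y = nameable (FuncEq.setoid (points X) (points Y)) (Codes X Y)
  (λ {p} {q} {f} {g} → resp {p} {q} {f} {g}) (λ {p} {f} {g} → fun {p} {f} {g})
  where
  module Y where
    open RepresentedSpace Y public using (⊩-resp; functional; _≈_)
    open Setoid (points Y) public using (refl)

  resp : ∀ {p q} {f g : Map X Y} → p ≗ q → (∀ x → Func.to f x Y.≈ Func.to g x) →
    Codes X Y p f → Codes X Y q g
  resp e f≈g (c , p0 , real) = c , trans (sym (e 0)) p0 , λ x n n⊩x →
    let y , run , y⊩fx = real x n n⊩x
    in y
     , (λ k → ⟦⟧-cong-oracle c (interleave-cong (e ∘ suc) (λ _ → refl)) (run k))
     , Y.⊩-resp (λ _ → refl) (f≈g x) y⊩fx

  fun : ∀ {p} {f g : Map X Y} → Codes X Y p f → Codes X Y p g →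
    ∀ x → Func.to f x Y.≈ Func.to g x
  fun (c , p0 , real) (d , p0′ , real′) x
    with refl ← encode-injective {c} {d} (trans (sym p0) p0′) =
    let n , n⊩x = surjective X x
        y , run , y⊩fx = real x n n⊩x
        z , run′ , z⊩gx = real′ x n n⊩x
    in Y.functional
         (Y.⊩-resp (λ k → ⟦⟧-functional c (run k) (run′ k)) Y.refl y⊩fx) z⊩gx

-- {⊤,⊥} is the set of truth values: p names A iff A says that p ≠ 0^ω.  Thus 0^ω
-- names ⊥ and every other sequence names ⊤.  (Bool instead of Set would turn
-- every open set into a decidable one.)
𝕊 : RepresentedSpace (lsuc 0ℓ) 0ℓ 0ℓ
𝕊 = nameable (⇔.⇔-setoid 0ℓ) (λ p A → A ⇔ (∃[ k ] p k ≢ 0))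
  (λ e A⇔B h → ⇔.trans (⇔.sym A⇔B) (⇔.trans h (≢0-cong e)))
  (λ h h′ → ⇔.trans h (⇔.sym h′))
  where
  ≢0-cong : ∀ {p q : Sequence} → p ≗ q → (∃[ k ] p k ≢ 0) ⇔ (∃[ k ] q k ≢ 0)
  ≢0-cong e = mk⇔ (λ (k , h) → k , λ q0 → h (trans (e k) q0))
                  (λ (k , h) → k , λ p0 → h (trans (sym (e k)) p0))

module _ {c ℓ r} (X : RepresentedSpace c ℓ r) where

  𝒪 : RepresentedSpace (lsuc 0ℓ ⊔ c ⊔ ℓ ⊔ r) c (c ⊔ r)
  𝒪 = X ⇒ᴿ 𝕊

  Contains : Carrier 𝒪 → Carrier X → Set
  Contains (χ , _) x = proj₁ (Func.to χ x)

  ComputablyOpen : ∀ {a} → (Carrier X → Set a) → Set (lsuc 0ℓ ⊔ c ⊔ ℓ ⊔ r ⊔ a)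
  ComputablyOpen P = ∃[ U ] ComputablePoint 𝒪 U × (∀ x → Contains U x ⇔ P x)

  Nonempty : Carrier 𝒪 → Set c
  Nonempty U = ∃[ x ] Contains U x

module _ {c ℓ r} (X : RepresentedSpace c ℓ r) where

  ComputablyDiscrete : Set (lsuc 0ℓ ⊔ c ⊔ ℓ ⊔ r)
  ComputablyDiscrete = ComputablyOpen (X ×ᴿ X) (λ (x , y) → x ≈ y)
    where open RepresentedSpace X using (_≈_)

  ComputablyOvert : Set (lsuc 0ℓ ⊔ c ⊔ ℓ ⊔ r)
  ComputablyOvert = ComputablyOpen (𝒪 X) (Nonempty X)

  -- Dedekind infinite: stronger than "not finite" without choice, and
  -- equivalent to it with countable choice.
  Infinite : Set (c ⊔ ℓ)
  Infinite = Injection (setoid ℕ) (points X)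

record IsIdeal (_≪_ : ℕ → ℕ → Set) (I : ℕ → Set) : Set where
  field
    nonempty   : ∃[ x ] I x
    downClosed : ∀ {x y} → x ≪ y → I y → I x
    directed   : ∀ {x y} → I x → I y → ∃[ z ] I z × x ≪ z × y ≪ z

IdealSetoid : (ℕ → ℕ → Set) → Setoid (lsuc 0ℓ) 0ℓ
IdealSetoid _≪_ = record
  { Carrier       = ∃[ I ] IsIdeal _≪_ I
  ; _≈_           = λ (I , _) (J , _) → ∀ n → I n ⇔ J n
  ; isEquivalence = record
    { refl  = λ n → ⇔.refl
    ; sym   = λ e n → ⇔.sym (e n)
    ; trans = λ e f n → ⇔.trans (e n) (f n)
    }
  }

𝐈 : (ℕ → ℕ → Set) → RepresentedSpace (lsuc 0ℓ) 0ℓ 0ℓ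
𝐈 _≪_ = nameable (IdealSetoid _≪_) (λ p (I , _) → ∀ n → I n ⇔ (∃[ k ] p k ≡ n))
  (λ e I≈J h n → ⇔.trans (⇔.sym (I≈J n)) (⇔.trans (h n) (range-cong e n)))
  (λ h h′ n → ⇔.trans (h n) (⇔.sym (h′ n)))
  where
  range-cong : ∀ {p q : Sequence} → p ≗ q → ∀ n → (∃[ k ] p k ≡ n) ⇔ (∃[ k ] q k ≡ n)
  range-cong e n = mk⇔ (λ (k , h) → k , trans (sym (e k)) h)
                       (λ (k , h) → k , trans (e k) h)

module _ {c ℓ r} (X : RepresentedSpace c ℓ r) where

  PrecomputablyQuasiPolish : Set (lsuc 0ℓ ⊔ c ⊔ ℓ ⊔ r)
  PrecomputablyQuasiPolish = Σ (ℕ → ℕ → Set) λ _≪_ →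
    Transitive _≪_ × ComputablyEnumerable _≪_ × ComputablyIsomorphic X (𝐈 _≪_)

  ComputablyQuasiPolish : Set (lsuc 0ℓ ⊔ c ⊔ ℓ ⊔ r)
  ComputablyQuasiPolish = PrecomputablyQuasiPolish × ComputablyOvert X

Constant : ∀ {c ℓ r c′ ℓ′ r′} (X : RepresentedSpace c ℓ r) (Y : RepresentedSpace c′ ℓ′ r′) →
  Map X Y → Set (c ⊔ ℓ′)
Constant X Y f = ∀ x y → Func.to f x ≈ Func.to f y
  where open RepresentedSpace Y using (_≈_)

{-# OPTIONS --safe #-}

-- X is ℕ modulo the computably enumerable equivalence relation ~ under which two states
-- of a stack machine are equivalent when their runs meet.  As ~ is an equivalence
-- relation, its ideals are the equivalence classes.  Two names, being enumerations of
-- classes, name the same point iff their ranges intersect, so X is discrete.  The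
-- classes have names uniformly in a representative, so X is overt: given a name of an
-- open set, simulate its program on all of these names in parallel.  Distinct halting
-- states are inequivalent, so X is infinite.  Finally, for every program c there is a
-- state `self (encode c)` whose run feeds c its own code and continues in the state
-- that c returns.  If f : X → ℕ is computable and a, b are states, let c look at
-- f [ self (encode c) ] and return a if this equals f [ b ], and b otherwise; since f
-- respects ~, this forces f [ a ] = f [ b ].

module Submission where

open import Defs
open import Level using (0ℓ) renaming (suc to lsuc)
open import Data.List.Base using (List; []; _∷_; map)
open import Data.List.Relation.Unary.All using (All; []; _∷_)
open import Data.Nat
  using (ℕ; zero; suc; pred; _+_; _*_; _∸_; _<_; s≤s; ∣_-_∣; ⌊_/2⌋; ⌈_/2⌉)
open import Data.Nat.GeneralisedArithmetic using (fold; fold-+)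
open import Data.Nat.Properties
  using (m≤n+m; +-comm; +-suc; +-identityʳ; pred[m∸n]≡m∸[1+n]; ∣m-n∣≡0⇒m≡n; m≡n⇒∣m-n∣≡0)
open import Data.Product using (Σ; ∃-syntax; _×_; _,_; proj₁; proj₂)
open import Function.Base using (_∘_)
open import Function.Bundles using (Func; _⇔_; mk⇔; Equivalence)
import Function.Construct.Identity as Identity
import Function.Properties.Equivalence as ⇔
open import Relation.Binary.Bundles using (Setoid)
open import Relation.Binary.Definitions using (Transitive)
open import Relation.Binary.PropositionalEquality
open import Relation.Nullary.Negation using (contradiction)

-- Pairing

π₁ π₂ : ℕ → ℕ
π₁ = proj₁ ∘ unpair
π₂ = proj₂ ∘ unpair

pair-next : ∀ a b → pair (proj₁ (next (a , b))) (proj₂ (next (a , b))) ≡ suc (pair a b)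
pair-next a zero    rewrite +-identityʳ a = refl
pair-next a (suc b) rewrite +-suc a b = refl

pair-unpair : ∀ n → pair (π₁ n) (π₂ n) ≡ n
pair-unpair zero    = refl
pair-unpair (suc n) =
  trans (pair-next (π₁ n) (π₂ n)) (cong suc (pair-unpair n))

-- An opaque copy of `pair`, since Agda would normalise `pair 9 x` to a huge term.
opaque
  ⟨_,_⟩ : ℕ → ℕ → ℕ
  ⟨_,_⟩ = pair

  ⟨⟩≡pair : ∀ a b → ⟨ a , b ⟩ ≡ pair a b
  ⟨⟩≡pair a b = refl

  π₁-⟨⟩ : ∀ a b → π₁ ⟨ a , b ⟩ ≡ a
  π₁-⟨⟩ a b = cong proj₁ (unpair-pair a b)

  π₂-⟨⟩ : ∀ a b → π₂ ⟨ a , b ⟩ ≡ b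
  π₂-⟨⟩ a b = cong proj₂ (unpair-pair a b)

  ⟨⟩-unpair : ∀ n → ⟨ π₁ n , π₂ n ⟩ ≡ n
  ⟨⟩-unpair = pair-unpair

pair-pair : ∀ a b c → pair a (pair b c) ≡ ⟨ a , ⟨ b , c ⟩ ⟩
pair-pair a b c = sym (trans (⟨⟩≡pair a _) (cong (pair a) (⟨⟩≡pair b c)))

⟨⟩-injectiveʳ : ∀ {a b a′ b′} → ⟨ a , b ⟩ ≡ ⟨ a′ , b′ ⟩ → b ≡ b′
⟨⟩-injectiveʳ {a} {b} {a′} {b′} e =
  trans (sym (π₂-⟨⟩ a b)) (trans (cong π₂ e) (π₂-⟨⟩ a′ b′))

-- The test for zero is an iteration, so that closure of `Recursive` under `fold` covers it.
ifz : ℕ → ℕ → ℕ → ℕ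
ifz n a b = fold a (λ _ → b) n

-- Total functions computable uniformly in the oracle

record Recursive (f : Sequence → ℕ → ℕ) : Set where
  constructor recursive
  field
    code     : Code
    computes : ∀ o n → ⟦ code ⟧ o n (f o n)

record Recursive₂ (f : Sequence → ℕ → ℕ → ℕ) : Set where
  constructor recursive₂
  field
    code     : Code
    computes : ∀ o a b → ⟦ code ⟧ o ⟨ a , b ⟩ (f o a b)

open Recursive
open Recursive₂ renaming (code to code₂; computes to computes₂)

-- Opaque, as the relation ⟦ c ⟧ unfolds to a huge type when c is a concrete program.
opaque
  ext : ∀ {f g} → (∀ o n → f o n ≡ g o n) → Recursive f → Recursive g
  ext e (recursive c h) = recursive c λ o n → subst (⟦ c ⟧ o n) (e o n) (h o n)

  curried : ∀ {f} → Recursive (λ o n → f o (π₁ n) (π₂ n)) → Recursive₂ f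
  curried {f} (recursive c h) = recursive₂ c λ o a b →
    subst (⟦ c ⟧ o ⟨ a , b ⟩) (cong₂ (f o) (π₁-⟨⟩ a b) (π₂-⟨⟩ a b)) (h o ⟨ a , b ⟩)

π₁ᴿ : Recursive (λ _ → π₁)
π₁ᴿ = recursive left λ _ _ → refl

π₂ᴿ : Recursive (λ _ → π₂)
π₂ᴿ = recursive right λ _ _ → refl

pairᴿ : ∀ {f g} → Recursive f → Recursive g → Recursive (λ o n → ⟨ f o n , g o n ⟩)
pairᴿ (recursive c h) (recursive d k) =
  recursive (pairing c d) λ o n → _ , _ , h o n , k o n , ⟨⟩≡pair _ _

infixr 9 _∘ᴿ_

_∘ᴿ_ : ∀ {f g} → Recursive f → Recursive g → Recursive (λ o n → f o (g o n))
recursive c h ∘ᴿ recursive d k = recursive (comp c d) λ o n → _ , k o n , h o _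

app₂ : ∀ {f g h} → Recursive₂ f → Recursive g → Recursive h →
  Recursive (λ o n → f o (g o n) (h o n))
app₂ (recursive₂ c h) g k =
  recursive (comp c (code (pairᴿ g k))) λ o n → _ , computes (pairᴿ g k) o n , h o _ _

idᴿ : Recursive (λ _ n → n)
idᴿ = ext (λ _ → ⟨⟩-unpair) (pairᴿ π₁ᴿ π₂ᴿ)

sucᴿ : ∀ {f} → Recursive f → Recursive (λ o n → suc (f o n))
sucᴿ f = recursive succ (λ _ _ → refl) ∘ᴿ f

constᴿ : ∀ k → Recursive (λ _ _ → k)
constᴿ zero    = recursive zero λ _ _ → refl
constᴿ (suc k) = sucᴿ (constᴿ k)

queryᴿ : ∀ {f} → Recursive f → Recursive (λ o n → o (f o n))
queryᴿ f = recursive query (λ _ _ → refl) ∘ᴿ f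

primRec-computes : ∀ {F G a z} {s : ℕ → ℕ → ℕ} (r : ℕ → ℕ) →
  r 0 ≡ z → (∀ m → r (suc m) ≡ s m (r m)) →
  F a z → (∀ m u → G ⟨ a , ⟨ m , u ⟩ ⟩ (s m u)) → ∀ m → PrimRec F G a m (r m)
primRec-computes {F} {a = a} r r0 rs Fz Gs zero = subst (F a) (sym r0) Fz
primRec-computes {G = G} {a} r r0 rs Fz Gs (suc m) =
  r m , primRec-computes {G = G} r r0 rs Fz Gs m
      , subst₂ G (sym (pair-pair a m (r m))) (sym (rs m)) (Gs m (r m))

-- `r` is specified by recursion equations, so that existing functions such as `pred` and `fold` fit
-- directly.
precᴿ : ∀ {b s} (r : Sequence → ℕ → ℕ → ℕ) → Recursive b → Recursive s →
  (∀ o a → r o a 0 ≡ b o a) →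
  (∀ o a m → r o a (suc m) ≡ s o ⟨ a , ⟨ m , r o a m ⟩ ⟩) → Recursive₂ r
precᴿ r (recursive c h) (recursive d k) r0 rs = curried
  (recursive (prec c d) λ o n →
    primRec-computes (r o (π₁ n)) (r0 o _) (rs o _) (h o _) (λ m u → k o _) (π₂ n))

predᴿ : ∀ {f} → Recursive f → Recursive (λ o n → pred (f o n))
predᴿ f = app₂ (precᴿ (λ _ _ → pred) (constᴿ 0) (π₁ᴿ ∘ᴿ π₂ᴿ) (λ _ _ → refl) pred-suc)
               (constᴿ 0) f
  where
  pred-suc : ∀ o a m → m ≡ π₁ (π₂ ⟨ a , ⟨ m , pred m ⟩ ⟩)
  pred-suc _ a m = sym (trans (cong π₁ (π₂-⟨⟩ a _)) (π₁-⟨⟩ m _))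

foldᴿ : ∀ {b t} g → Recursive b → Recursive₂ g → Recursive t →
  Recursive (λ o n → fold (b o n) (g o n) (t o n))
foldᴿ {b} g b′ g′ t′ = app₂
  (precᴿ (λ o a → fold (b o a) (g o a)) b′ (app₂ g′ π₁ᴿ (π₂ᴿ ∘ᴿ π₂ᴿ)) (λ _ _ → refl)
    λ o a m → let u = fold (b o a) (g o a) m in
      sym (cong₂ (g o) (π₁-⟨⟩ a _) (trans (cong π₂ (π₂-⟨⟩ a _)) (π₂-⟨⟩ m u))))
  idᴿ t′

ifzᴿ : ∀ {t f g} → Recursive t → Recursive f → Recursive g →
  Recursive (λ o n → ifz (t o n) (f o n) (g o n))
ifzᴿ {g = g′} t f g = foldᴿ (λ o n _ → g′ o n) f (curried (g ∘ᴿ π₁ᴿ)) t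

fold-pred : ∀ a b → fold a pred b ≡ a ∸ b
fold-pred a zero    = refl
fold-pred a (suc b) = trans (cong pred (fold-pred a b)) (pred[m∸n]≡m∸[1+n] a b)

∸ᴿ : ∀ {f g} → Recursive f → Recursive g → Recursive (λ o n → f o n ∸ g o n)
∸ᴿ {f} {g} f′ g′ = ext (λ o n → fold-pred (f o n) (g o n))
  (foldᴿ (λ _ _ → pred) f′ (curried (predᴿ π₂ᴿ)) g′)

distance-∸ : ∀ a b → ifz (a ∸ b) (b ∸ a) (a ∸ b) ≡ ∣ a - b ∣
distance-∸ zero    zero    = refl
distance-∸ zero    (suc b) = refl
distance-∸ (suc a) zero    = refl
distance-∸ (suc a) (suc b) = distance-∸ a b

distanceᴿ : ∀ {f g} → Recursive f → Recursive g → Recursive (λ o n → ∣ f o n - g o n ∣)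
distanceᴿ {f} {g} f′ g′ = ext (λ o n → distance-∸ (f o n) (g o n))
  (ifzᴿ (∸ᴿ f′ g′) (∸ᴿ g′ f′) (∸ᴿ f′ g′))

fold-double : ∀ n → fold 0 (suc ∘ suc) n ≡ 2 * n
fold-double zero    = refl
fold-double (suc n) =
  cong suc (trans (cong suc (fold-double n)) (sym (+-suc n (n + 0))))

doubleᴿ : ∀ {f} → Recursive f → Recursive (λ o n → 2 * f o n)
doubleᴿ {f} f′ = ext (λ o n → fold-double (f o n))
  (foldᴿ (λ _ _ → suc ∘ suc) (constᴿ 0) (curried (sucᴿ (sucᴿ π₂ᴿ))) f′)

-- Both halves are iterated together, since ⌊(n+1)/2⌋ = ⌈n/2⌉ and ⌈(n+1)/2⌉ = ⌊n/2⌋ + 1.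
halves : ℕ → ℕ
halves = fold ⟨ 0 , 0 ⟩ λ u → ⟨ π₂ u , suc (π₁ u) ⟩

halves-correct : ∀ n → halves n ≡ ⟨ ⌊ n /2⌋ , ⌈ n /2⌉ ⟩
halves-correct zero    = refl
halves-correct (suc n) rewrite halves-correct n =
  cong₂ ⟨_,_⟩ (π₂-⟨⟩ ⌊ n /2⌋ _) (cong suc (π₁-⟨⟩ ⌊ n /2⌋ _))

halvesᴿ : ∀ {f} → Recursive f → Recursive (λ o n → halves (f o n))
halvesᴿ f = foldᴿ (λ _ _ u → ⟨ π₂ u , suc (π₁ u) ⟩) (pairᴿ (constᴿ 0) (constᴿ 0))
  (curried (pairᴿ (π₂ᴿ ∘ᴿ π₂ᴿ) (sucᴿ (π₁ᴿ ∘ᴿ π₂ᴿ)))) f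

⌊/2⌋ᴿ : ∀ {f} → Recursive f → Recursive (λ o n → ⌊ f o n /2⌋)
⌊/2⌋ᴿ {f} f′ = ext
  (λ o n → trans (cong π₁ (halves-correct (f o n))) (π₁-⟨⟩ ⌊ f o n /2⌋ _))
  (π₁ᴿ ∘ᴿ halvesᴿ f′)

⌈/2⌉ᴿ : ∀ {f} → Recursive f → Recursive (λ o n → ⌈ f o n /2⌉)
⌈/2⌉ᴿ {f} f′ = ext
  (λ o n → trans (cong π₂ (halves-correct (f o n))) (π₂-⟨⟩ ⌊ f o n /2⌋ _))
  (π₂ᴿ ∘ᴿ halvesᴿ f′)

-- The difference ⌈n/2⌉ ∸ ⌊n/2⌋ is the parity of `n`, which decides between `p` and `q`.
interleave-halves : ∀ p q n →
  ifz (⌈ n /2⌉ ∸ ⌊ n /2⌋) (p ⌊ n /2⌋) (q ⌊ n /2⌋) ≡ interleave p q n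
interleave-halves p q zero          = refl
interleave-halves p q (suc zero)    = refl
interleave-halves p q (suc (suc n)) = interleave-halves (p ∘ suc) (q ∘ suc) n

interleaveᴿ : ∀ {p q} → Recursive₂ p → Recursive₂ q →
  Recursive₂ (λ o e → interleave (p o e) (q o e))
interleaveᴿ p q = curried (ext (λ o n → interleave-halves _ _ (π₂ n))
  (ifzᴿ (∸ᴿ (⌈/2⌉ᴿ π₂ᴿ) (⌊/2⌋ᴿ π₂ᴿ)) (app₂ p π₁ᴿ (⌊/2⌋ᴿ π₂ᴿ)) (app₂ q π₁ᴿ (⌊/2⌋ᴿ π₂ᴿ))))

-- Finite case distinction and unbounded search

select : ℕ → List ℕ → ℕ → ℕ
select t       []       d = d
select zero    (x ∷ xs) d = x
select (suc t) (x ∷ xs) d = select t xs d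

ifz-select : ∀ t x xs d → ifz t x (select (pred t) xs d) ≡ select t (x ∷ xs) d
ifz-select zero    x xs d = refl
ifz-select (suc t) x xs d = refl

selectᴿ : ∀ {t fs d} → Recursive t → All Recursive fs → Recursive d →
  Recursive (λ o n → select (t o n) (map (λ f → f o n) fs) (d o n))
selectᴿ t []       d = d
selectᴿ {t′} {f′ ∷ fs′} {d′} t (f ∷ fs) d = ext
  (λ o n → ifz-select (t′ o n) (f′ o n) (map (λ g → g o n) fs′) (d′ o n))
  (ifzᴿ t f (selectᴿ (predᴿ t) fs d))

-- The known root `t` makes the recursion terminate: it decreases whenever `f` is shifted by one.
least : ∀ (f : ℕ → ℕ) t → f t ≡ 0 →
  ∃[ v ] f v ≡ 0 × (∀ m → m < v → ∃[ w ] f m ≡ suc w)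
least f t ft with f 0 in f0
... | zero = 0 , f0 , λ _ ()
least f zero    ft | suc w = contradiction (trans (sym ft) f0) λ ()
least f (suc t) ft | suc w with least (f ∘ suc) t ft
... | v , fv , below = suc v , fv , λ where
  zero    _         → w , f0
  (suc m) (s≤s m<v) → below m m<v

search : ∀ {f} (r : Recursive₂ f) {o n} t → f o n t ≡ 0 → ∃[ v ] ⟦ μ (code₂ r) ⟧ o n v
search {f} (recursive₂ c h) {o} {n} t ft with least (f o n) t ft
... | v , fv , below =
  v , subst (⟦ c ⟧ o _) fv (computes-pair v)
    , λ m m<v → let w , fm = below m m<v in w , subst (⟦ c ⟧ o _) fm (computes-pair m)
  where
  computes-pair : ∀ t → ⟦ c ⟧ o (pair n t) (f o n t)
  computes-pair t = subst (λ i → ⟦ c ⟧ o i (f o n t)) (⟨⟩≡pair n t) (h o n t)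

search-sound : ∀ {f} (r : Recursive₂ f) {o n v} → ⟦ μ (code₂ r) ⟧ o n v → f o n v ≡ 0
search-sound r {o} {n} {v} (z , _) = ⟦⟧-functional (code₂ r) (computes₂ r o n v)
  (subst (λ i → ⟦ code₂ r ⟧ o i 0) (sym (⟨⟩≡pair n v)) z)

-- A stack machine
--
-- A state ⟨ ⟨ f , k ⟩ , v ⟩ is about to apply the frame f, on top of the stack k, to the
-- value v.  A frame is ⟨ t , d ⟩ with a tag t: 0–8 are programs, as encoded by `encode`;
-- 9–12 are suspended evaluations of `pairing` (9, 10), `prec` (11) and `μ` (12); 13 makes
-- the value the next state; from 14 on the machine has halted.

successors : Sequence → ℕ → ℕ → ℕ → List ℕ
successors q d k v =
    ⟨ k , 0 ⟩
  ∷ ⟨ k , suc v ⟩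
  ∷ ⟨ k , π₁ v ⟩
  ∷ ⟨ k , π₂ v ⟩
  ∷ ⟨ k , q v ⟩
  ∷ ⟨ ⟨ π₁ d , ⟨ ⟨ 9 , ⟨ π₂ d , v ⟩ ⟩ , k ⟩ ⟩ , v ⟩
  -- The code of a program is already a frame, so the outer program of `comp` is pushed as it
  -- stands.
  ∷ ⟨ ⟨ π₂ d , ⟨ π₁ d , k ⟩ ⟩ , v ⟩
  -- `prec` at a successor re-enters its own frame at the predecessor, above a frame 11 that will
  -- apply the step program.
  ∷ ifz (π₂ v)
      ⟨ ⟨ π₁ d , k ⟩ , π₁ v ⟩
      ⟨ ⟨ ⟨ 7 , d ⟩ ,
                  ⟨ ⟨ 11 , ⟨ π₂ d , ⟨ π₁ v , pred (π₂ v) ⟩ ⟩ ⟩ , k ⟩ ⟩ ,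
            ⟨ π₁ v , pred (π₂ v) ⟩ ⟩
  ∷ ⟨ ⟨ d , ⟨ ⟨ 12 , ⟨ d , ⟨ v , 0 ⟩ ⟩ ⟩ , k ⟩ ⟩ , ⟨ v , 0 ⟩ ⟩
  ∷ ⟨ ⟨ π₁ d , ⟨ ⟨ 10 , v ⟩ , k ⟩ ⟩ , π₂ d ⟩
  ∷ ⟨ k , ⟨ d , v ⟩ ⟩
  ∷ ⟨ ⟨ π₁ d , k ⟩ , ⟨ π₁ (π₂ d) , ⟨ π₂ (π₂ d) , v ⟩ ⟩ ⟩
  -- Value 0 means that the candidate is a root; otherwise the next candidate is tried.
  ∷ ifz v
      ⟨ k , π₂ (π₂ d) ⟩
      ⟨ ⟨ π₁ d ,
                  ⟨ ⟨ 12 , ⟨ π₁ d , ⟨ π₁ (π₂ d) , suc (π₂ (π₂ d)) ⟩ ⟩ ⟩ , k ⟩ ⟩ ,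
            ⟨ π₁ (π₂ d) , (suc (π₂ (π₂ d))) ⟩ ⟩
  ∷ v
  ∷ []

tag datum stack value : ℕ → ℕ
tag   s = π₁ (π₁ (π₁ s))
datum s = π₂ (π₁ (π₁ s))
stack s = π₂ (π₁ s)
value s = π₂ s

-- The default `s` makes halted states fixed points.
transition : Sequence → ℕ → ℕ
transition q s = select (tag s) (successors q (datum s) (stack s) (value s)) s

-- Opaque, so that normalisation leaves runs of the machine folded.
opaque
  step : Sequence → ℕ → ℕ
  step = transition

  step-transition : ∀ q s → transition q s ≡ step q s
  step-transition _ _ = refl

transitionᴿ : ∀ {q} → Recursive₂ q → Recursive (λ o n → transition (q o (π₁ n)) (π₂ n))
transitionᴿ {q} qᴿ = selectᴿ (π₁ᴿ ∘ᴿ π₁ᴿ ∘ᴿ π₁ᴿ ∘ᴿ s)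
  ( pairᴿ k (constᴿ 0)
  ∷ pairᴿ k (sucᴿ v)
  ∷ pairᴿ k (π₁ᴿ ∘ᴿ v)
  ∷ pairᴿ k (π₂ᴿ ∘ᴿ v)
  ∷ pairᴿ k (app₂ qᴿ π₁ᴿ v)
  ∷ pairᴿ (pairᴿ d₁ (pairᴿ (pairᴿ (constᴿ 9) (pairᴿ d₂ v)) k)) v
  ∷ pairᴿ (pairᴿ d₂ (pairᴿ d₁ k)) v
  ∷ ifzᴿ (π₂ᴿ ∘ᴿ v)
      (pairᴿ (pairᴿ d₁ k) (π₁ᴿ ∘ᴿ v))
      (pairᴿ (pairᴿ (pairᴿ (constᴿ 7) d)
                    (pairᴿ (pairᴿ (constᴿ 11) (pairᴿ d₂ v⁻)) k))
             v⁻)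
  ∷ pairᴿ (pairᴿ d (pairᴿ (pairᴿ (constᴿ 12) (pairᴿ d (pairᴿ v (constᴿ 0)))) k))
          (pairᴿ v (constᴿ 0))
  ∷ pairᴿ (pairᴿ d₁ (pairᴿ (pairᴿ (constᴿ 10) v) k)) d₂
  ∷ pairᴿ k (pairᴿ d v)
  ∷ pairᴿ (pairᴿ d₁ k) (pairᴿ d₂₁ (pairᴿ d₂₂ v))
  ∷ ifzᴿ v
      (pairᴿ k d₂₂)
      (pairᴿ (pairᴿ d₁
                    (pairᴿ (pairᴿ (constᴿ 12) (pairᴿ d₁ (pairᴿ d₂₁ (sucᴿ d₂₂)))) k))
             (pairᴿ d₂₁ (sucᴿ d₂₂)))
  ∷ v
  ∷ []) s
  where
  s   = π₂ᴿ
  d   = π₂ᴿ ∘ᴿ π₁ᴿ ∘ᴿ π₁ᴿ ∘ᴿ s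
  k   = π₂ᴿ ∘ᴿ π₁ᴿ ∘ᴿ s
  v   = π₂ᴿ ∘ᴿ s
  v⁻  = pairᴿ (π₁ᴿ ∘ᴿ v) (predᴿ (π₂ᴿ ∘ᴿ v))
  d₁  = π₁ᴿ ∘ᴿ d
  d₂  = π₂ᴿ ∘ᴿ d
  d₂₁ = π₁ᴿ ∘ᴿ d₂
  d₂₂ = π₂ᴿ ∘ᴿ d₂

stepᴿ : ∀ {q} → Recursive₂ q → Recursive₂ (λ o e → step (q o e))
stepᴿ {q} qᴿ =
  curried (ext (λ o n → step-transition (q o (π₁ n)) (π₂ n)) (transitionᴿ qᴿ))

-- Simulation of programs by the machine

⌜_⌝ : Code → ℕ
⌜ zero ⌝        = ⟨ 0 , 0 ⟩
⌜ succ ⌝        = ⟨ 1 , 0 ⟩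
⌜ left ⌝        = ⟨ 2 , 0 ⟩
⌜ right ⌝       = ⟨ 3 , 0 ⟩
⌜ query ⌝       = ⟨ 4 , 0 ⟩
⌜ pairing c d ⌝ = ⟨ 5 , ⟨ ⌜ c ⌝ , ⌜ d ⌝ ⟩ ⟩
⌜ comp c d ⌝    = ⟨ 6 , ⟨ ⌜ c ⌝ , ⌜ d ⌝ ⟩ ⟩
⌜ prec c d ⌝    = ⟨ 7 , ⟨ ⌜ c ⌝ , ⌜ d ⌝ ⟩ ⟩
⌜ μ c ⌝         = ⟨ 8 , ⌜ c ⌝ ⟩

opaque
  unfolding ⟨_,_⟩

  -- Links the Gödel numbers to their opaque copies, which keep codes folded during the simulation.
  ⌜⌝≡encode : ∀ c → ⌜ c ⌝ ≡ encode c
  ⌜⌝≡encode zero          = refl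
  ⌜⌝≡encode succ          = refl
  ⌜⌝≡encode left          = refl
  ⌜⌝≡encode right         = refl
  ⌜⌝≡encode query         = refl
  ⌜⌝≡encode (pairing c d) = cong₂ (λ x y → pair 5 (pair x y)) (⌜⌝≡encode c) (⌜⌝≡encode d)
  ⌜⌝≡encode (comp c d)    = cong₂ (λ x y → pair 6 (pair x y)) (⌜⌝≡encode c) (⌜⌝≡encode d)
  ⌜⌝≡encode (prec c d)    = cong₂ (λ x y → pair 7 (pair x y)) (⌜⌝≡encode c) (⌜⌝≡encode d)
  ⌜⌝≡encode (μ c)         = cong (pair 8) (⌜⌝≡encode c)

step-frame : ∀ q t d k v → let s = ⟨ ⟨ ⟨ t , d ⟩ , k ⟩ , v ⟩ in
  step q s ≡ select t (successors q d k v) s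
step-frame q t d k v = trans (sym (step-transition q s)) (trans
  (cong₂ (λ t d → next-state t d (stack s) (value s)) tag≡ datum≡)
  (cong₂ (next-state t d) stack≡ (π₂-⟨⟩ ⟨ f , k ⟩ v)))
  where
  f = ⟨ t , d ⟩
  s = ⟨ ⟨ f , k ⟩ , v ⟩

  next-state : ℕ → ℕ → ℕ → ℕ → ℕ
  next-state t d k v = select t (successors q d k v) s

  top≡ : π₁ s ≡ ⟨ f , k ⟩
  top≡ = π₁-⟨⟩ ⟨ f , k ⟩ v
  frame≡ : π₁ (π₁ s) ≡ f
  frame≡ = trans (cong π₁ top≡) (π₁-⟨⟩ f k)
  tag≡ : tag s ≡ t
  tag≡ = trans (cong π₁ frame≡) (π₁-⟨⟩ t d)
  datum≡ : datum s ≡ d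
  datum≡ = trans (cong π₂ frame≡) (π₂-⟨⟩ t d)
  stack≡ : stack s ≡ k
  stack≡ = trans (cong π₂ top≡) (π₂-⟨⟩ f k)

record _⊢_↝_ (q : Sequence) (s s′ : ℕ) : Set where
  constructor after
  field
    time    : ℕ
    arrives : fold s (step q) time ≡ s′

infixr 5 _⨾_

_⨾_ : ∀ {q s s′ s″} → q ⊢ s ↝ s′ → q ⊢ s′ ↝ s″ → q ⊢ s ↝ s″
_⨾_ {q} {s} (after t refl) (after u refl) = after (u + t) (fold-+ s (step q) u)

frame : ∀ {q s} t d k v → select t (successors q d k v) ⟨ ⟨ ⟨ t , d ⟩ , k ⟩ , v ⟩ ≡ s →
  q ⊢ ⟨ ⟨ ⟨ t , d ⟩ , k ⟩ , v ⟩ ↝ s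
frame {q} t d k v e = after 1 (trans (step-frame q t d k v) e)

module _ (q : Sequence) where

  pairing-frame : ∀ c d k v →
    q ⊢ ⟨ ⟨ ⟨ 5 , ⟨ c , d ⟩ ⟩ , k ⟩ , v ⟩
      ↝ ⟨ ⟨ c , ⟨ ⟨ 9 , ⟨ d , v ⟩ ⟩ , k ⟩ ⟩ , v ⟩
  pairing-frame c d k v = frame 5 ⟨ c , d ⟩ k v
    (cong₂ (λ c d → ⟨ ⟨ c , ⟨ ⟨ 9 , ⟨ d , v ⟩ ⟩ , k ⟩ ⟩ , v ⟩) (π₁-⟨⟩ c d) (π₂-⟨⟩ c d))

  pairing-frame′ : ∀ d n k v →
    q ⊢ ⟨ ⟨ ⟨ 9 , ⟨ d , n ⟩ ⟩ , k ⟩ , v ⟩ ↝ ⟨ ⟨ d , ⟨ ⟨ 10 , v ⟩ , k ⟩ ⟩ , n ⟩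
  pairing-frame′ d n k v = frame 9 ⟨ d , n ⟩ k v
    (cong₂ (λ d n → ⟨ ⟨ d , ⟨ ⟨ 10 , v ⟩ , k ⟩ ⟩ , n ⟩) (π₁-⟨⟩ d n) (π₂-⟨⟩ d n))

  comp-frame : ∀ c d k v →
    q ⊢ ⟨ ⟨ ⟨ 6 , ⟨ c , d ⟩ ⟩ , k ⟩ , v ⟩ ↝ ⟨ ⟨ d , ⟨ c , k ⟩ ⟩ , v ⟩
  comp-frame c d k v = frame 6 ⟨ c , d ⟩ k v
    (cong₂ (λ c d → ⟨ ⟨ d , ⟨ c , k ⟩ ⟩ , v ⟩) (π₁-⟨⟩ c d) (π₂-⟨⟩ c d))

  prec-enter : ℕ → ℕ → ℕ → ℕ → ℕ → ℕ
  prec-enter d k a m f = ⟨ ⟨ f , ⟨ ⟨ 11 , ⟨ d , ⟨ a , m ⟩ ⟩ ⟩ , k ⟩ ⟩ , ⟨ a , m ⟩ ⟩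

  prec-frame-zero : ∀ c d k v → π₂ v ≡ 0 →
    q ⊢ ⟨ ⟨ ⟨ 7 , ⟨ c , d ⟩ ⟩ , k ⟩ , v ⟩ ↝ ⟨ ⟨ c , k ⟩ , π₁ v ⟩
  prec-frame-zero c d k v v₂ = frame 7 ⟨ c , d ⟩ k v (trans
    (cong (λ m → ifz m ⟨ ⟨ π₁ ⟨ c , d ⟩ , k ⟩ , π₁ v ⟩
                   (prec-enter (π₂ ⟨ c , d ⟩) k (π₁ v) (pred m) ⟨ 7 , ⟨ c , d ⟩ ⟩)) v₂)
    (cong (λ c → ⟨ ⟨ c , k ⟩ , π₁ v ⟩) (π₁-⟨⟩ c d)))

  prec-frame-suc : ∀ c d k v {a m} → π₁ v ≡ a → π₂ v ≡ suc m →
    q ⊢ ⟨ ⟨ ⟨ 7 , ⟨ c , d ⟩ ⟩ , k ⟩ , v ⟩ ↝ prec-enter d k a m ⟨ 7 , ⟨ c , d ⟩ ⟩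
  prec-frame-suc c d k v {m = m} refl v₂ = frame 7 ⟨ c , d ⟩ k v (trans
    (cong (λ m → ifz m ⟨ ⟨ π₁ ⟨ c , d ⟩ , k ⟩ , π₁ v ⟩
                   (prec-enter (π₂ ⟨ c , d ⟩) k (π₁ v) (pred m) ⟨ 7 , ⟨ c , d ⟩ ⟩)) v₂)
    (cong (λ d′ → prec-enter d′ k (π₁ v) m ⟨ 7 , ⟨ c , d ⟩ ⟩) (π₂-⟨⟩ c d)))

  prec-frame′ : ∀ d a m k u →
    q ⊢ ⟨ ⟨ ⟨ 11 , ⟨ d , ⟨ a , m ⟩ ⟩ ⟩ , k ⟩ , u ⟩ ↝ ⟨ ⟨ d , k ⟩ , ⟨ a , ⟨ m , u ⟩ ⟩ ⟩
  prec-frame′ d a m k u = frame 11 ⟨ d , ⟨ a , m ⟩ ⟩ k u e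
    where
    e : ⟨ ⟨ π₁ ⟨ d , ⟨ a , m ⟩ ⟩ , k ⟩ ,
             ⟨ π₁ (π₂ ⟨ d , ⟨ a , m ⟩ ⟩) , ⟨ π₂ (π₂ ⟨ d , ⟨ a , m ⟩ ⟩) , u ⟩ ⟩ ⟩
        ≡ ⟨ ⟨ d , k ⟩ , ⟨ a , ⟨ m , u ⟩ ⟩ ⟩
    e rewrite π₁-⟨⟩ d ⟨ a , m ⟩ | π₂-⟨⟩ d ⟨ a , m ⟩ | π₁-⟨⟩ a m | π₂-⟨⟩ a m = refl

  μ-frame-found : ∀ c n i k → q ⊢ ⟨ ⟨ ⟨ 12 , ⟨ c , ⟨ n , i ⟩ ⟩ ⟩ , k ⟩ , 0 ⟩ ↝ ⟨ k , i ⟩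
  μ-frame-found c n i k = frame 12 ⟨ c , ⟨ n , i ⟩ ⟩ k 0
    (cong ⟨ k ,_⟩ (trans (cong π₂ (π₂-⟨⟩ c ⟨ n , i ⟩)) (π₂-⟨⟩ n i)))

  μ-frame-next : ∀ c n i k w →
    q ⊢ ⟨ ⟨ ⟨ 12 , ⟨ c , ⟨ n , i ⟩ ⟩ ⟩ , k ⟩ , suc w ⟩
      ↝ ⟨ ⟨ c , ⟨ ⟨ 12 , ⟨ c , ⟨ n , suc i ⟩ ⟩ ⟩ , k ⟩ ⟩ , ⟨ n , suc i ⟩ ⟩
  μ-frame-next c n i k w = frame 12 ⟨ c , ⟨ n , i ⟩ ⟩ k (suc w) e
    where
    next-state : ℕ → ℕ → ℕ → ℕ
    next-state c n i =
      ⟨ ⟨ c , ⟨ ⟨ 12 , ⟨ c , ⟨ n , suc i ⟩ ⟩ ⟩ , k ⟩ ⟩ , ⟨ n , suc i ⟩ ⟩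

    d₂ : π₂ ⟨ c , ⟨ n , i ⟩ ⟩ ≡ ⟨ n , i ⟩
    d₂ = π₂-⟨⟩ c ⟨ n , i ⟩

    e : next-state (π₁ ⟨ c , ⟨ n , i ⟩ ⟩) (π₁ (π₂ ⟨ c , ⟨ n , i ⟩ ⟩))
                   (π₂ (π₂ ⟨ c , ⟨ n , i ⟩ ⟩)) ≡ next-state c n i
    e = trans (cong₂ (λ c d → next-state c (π₁ d) (π₂ d)) (π₁-⟨⟩ c ⟨ n , i ⟩) d₂)
              (cong₂ (next-state c) (π₁-⟨⟩ n i) (π₂-⟨⟩ n i))

-- Induction on `c`, with `k` arbitrary so that subprograms can run on top of pushed frames. Only
-- halting runs are simulated; uniqueness of the result comes from `halted-unique`.
simulates : ∀ c {q n v} k → ⟦ c ⟧ q n v → q ⊢ ⟨ ⟨ ⌜ c ⌝ , k ⟩ , n ⟩ ↝ ⟨ k , v ⟩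
simulates zero  k refl = frame 0 0 k _ refl
simulates succ  k refl = frame 1 0 k _ refl
simulates left  k refl = frame 2 0 k _ refl
simulates right k refl = frame 3 0 k _ refl
simulates query k refl = frame 4 0 k _ refl
simulates (pairing c d) {q} k (a , b , h , h′ , refl) rewrite sym (⟨⟩≡pair a b) =
  pairing-frame q ⌜ c ⌝ ⌜ d ⌝ k _
  ⨾ simulates c _ h ⨾ pairing-frame′ q ⌜ d ⌝ _ k a
  ⨾ simulates d _ h′ ⨾ frame 10 a k b refl
simulates (comp c d) {q} k (m , h , h′) =
  comp-frame q ⌜ c ⌝ ⌜ d ⌝ k _ ⨾ simulates d _ h ⨾ simulates c k h′
simulates (prec c d) {q} k h = go _ _ _ refl refl k h
  where
  -- Since `prec c d` is re-entered at `⟨ a , m ⟩`, the induction on `m` ranges over all inputs `n`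
  -- with the given components.
  go : ∀ m a n → π₁ n ≡ a → π₂ n ≡ m → ∀ k {v} → PrimRec (⟦ c ⟧ q) (⟦ d ⟧ q) a m v →
    q ⊢ ⟨ ⟨ ⌜ prec c d ⌝ , k ⟩ , n ⟩ ↝ ⟨ k , v ⟩
  go zero    _ n refl n₂ k h =
    prec-frame-zero q ⌜ c ⌝ ⌜ d ⌝ k n n₂ ⨾ simulates c k h
  go (suc m) a n n₁ n₂ k (u , h , h′) =
    prec-frame-suc q ⌜ c ⌝ ⌜ d ⌝ k n n₁ n₂
    ⨾ go m a ⟨ a , m ⟩ (π₁-⟨⟩ a m) (π₂-⟨⟩ a m) _ h
    ⨾ prec-frame′ q ⌜ d ⌝ a m k u
    ⨾ simulates d k (subst (λ i → ⟦ d ⟧ q i _) (pair-pair a m u) h′)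
simulates (μ c) {q} {n} {v} k (h , below) =
  frame 8 ⌜ c ⌝ k n refl ⨾ go v 0 (+-identityʳ v)
  where
  on-⟨⟩ : ∀ {i w} → ⟦ c ⟧ q (pair n i) w → ⟦ c ⟧ q ⟨ n , i ⟩ w
  on-⟨⟩ = subst (λ j → ⟦ c ⟧ q j _) (sym (⟨⟩≡pair n _))

  -- `i` is the candidate under test, and the induction is on its distance `j` from the least root
  -- `v`.
  go : ∀ j i → j + i ≡ v →
    q ⊢ ⟨ ⟨ ⌜ c ⌝ , ⟨ ⟨ 12 , ⟨ ⌜ c ⌝ , ⟨ n , i ⟩ ⟩ ⟩ , k ⟩ ⟩ , ⟨ n , i ⟩ ⟩
      ↝ ⟨ k , v ⟩
  go zero    i refl = simulates c _ (on-⟨⟩ h) ⨾ μ-frame-found q ⌜ c ⌝ n i k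
  go (suc j) i e    =
    let w , h′ = below i (subst (i <_) e (s≤s (m≤n+m i j)))
    in simulates c _ (on-⟨⟩ h′) ⨾ μ-frame-next q ⌜ c ⌝ n i k w
       ⨾ go j (suc i) (trans (+-suc j i) e)

-- Stacks of one frame: a result returned to `jump` becomes the next state, while one returned to
-- `halt` is final.
jump halt : ℕ
jump = ⟨ ⟨ 13 , 0 ⟩ , 0 ⟩
halt = ⟨ ⟨ 14 , 0 ⟩ , 0 ⟩

-- Zero signals a halted state, in the form that `μ` and `ifz` test.
running : ℕ → ℕ
running s = 14 ∸ tag s

runningᴿ : ∀ {f} → Recursive f → Recursive (λ o n → running (f o n))
runningᴿ f = ∸ᴿ (constᴿ 14) (π₁ᴿ ∘ᴿ π₁ᴿ ∘ᴿ π₁ᴿ ∘ᴿ f)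

halted-select : ∀ t q d k v s → 14 ∸ t ≡ 0 → select t (successors q d k v) s ≡ s
-- The equation rules out the tags 0 to 13; fourteen successors let `select` run off its list.
halted-select (suc (suc (suc (suc (suc (suc (suc (suc (suc (suc (suc (suc (suc (suc t))))))))))))))
  q d k v s _ = refl

halted-step : ∀ q s → running s ≡ 0 → step q s ≡ s
halted-step q s h =
  trans (sym (step-transition q s)) (halted-select (tag s) q _ _ _ s h)

halted-fold : ∀ q s → running s ≡ 0 → ∀ t → fold s (step q) t ≡ s
halted-fold q s h zero    = refl
halted-fold q s h (suc t) = trans (cong (step q) (halted-fold q s h t)) (halted-step q s h)

running-halt : ∀ v → running ⟨ halt , v ⟩ ≡ 0
running-halt v
  rewrite π₁-⟨⟩ halt v | π₁-⟨⟩ ⟨ 14 , 0 ⟩ 0 | π₁-⟨⟩ 14 0 = refl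

-- Halted states are fixed, so both runs may be prolonged to the common time `t + u`.
halted-unique : ∀ q s t u →
  running (fold s (step q) t) ≡ 0 → running (fold s (step q) u) ≡ 0 →
  fold s (step q) t ≡ fold s (step q) u
halted-unique q s t u h h′ = begin
  fold s (step q) t                      ≡⟨ halted-fold q _ h u ⟨
  fold (fold s (step q) t) (step q) u    ≡⟨ fold-+ s (step q) u ⟨
  fold s (step q) (u + t)                ≡⟨ cong (fold s (step q)) (+-comm u t) ⟩
  fold s (step q) (t + u)                ≡⟨ fold-+ s (step q) t ⟩
  fold (fold s (step q) u) (step q) t    ≡⟨ halted-fold q _ h′ t ⟩
  fold s (step q) u                      ∎
  where open ≡-Reasoning

-- Two states are equivalent when their runs meet

step₀ : ℕ → ℕ
step₀ = step 0ω

_~_ : ℕ → ℕ → Set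
x ~ y = ∃[ i ] ∃[ j ] fold x step₀ i ≡ fold y step₀ j

~-refl : ∀ {x} → x ~ x
~-refl = 0 , 0 , refl

~-sym : ∀ {x y} → x ~ y → y ~ x
~-sym (i , j , e) = j , i , sym e

-- Both meetings are carried forward to the state of `y` after `j + k` steps.
~-trans : Transitive _~_
~-trans {x} {y} {z} (i , j , e) (k , l , e′) = k + i , j + l , (begin
  fold x step₀ (k + i)          ≡⟨ fold-+ x step₀ k ⟩
  fold (fold x step₀ i) step₀ k ≡⟨ cong (λ u → fold u step₀ k) e ⟩
  fold (fold y step₀ j) step₀ k ≡⟨ fold-+ y step₀ k ⟨
  fold y step₀ (k + j)          ≡⟨ cong (fold y step₀) (+-comm k j) ⟩
  fold y step₀ (j + k)          ≡⟨ fold-+ y step₀ j ⟩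
  fold (fold y step₀ k) step₀ j ≡⟨ cong (λ u → fold u step₀ j) e′ ⟩
  fold (fold z step₀ l) step₀ j ≡⟨ fold-+ z step₀ j ⟨
  fold z step₀ (j + l)          ∎)
  where open ≡-Reasoning

↝⇒~ : ∀ {x y} → 0ω ⊢ x ↝ y → x ~ y
↝⇒~ (after t e) = t , 0 , e

halted-~ : ∀ {x y} → running x ≡ 0 → running y ≡ 0 → x ~ y → x ≡ y
halted-~ {x} {y} hx hy (i , j , e) =
  trans (sym (halted-fold 0ω x hx i)) (trans e (halted-fold 0ω y hy j))

step₀-foldᴿ : ∀ {f t} → Recursive f → Recursive t →
  Recursive (λ o n → fold (f o n) step₀ (t o n))
step₀-foldᴿ f t = foldᴿ (λ _ _ → step₀) f (stepᴿ {λ _ _ → 0ω} (curried (constᴿ 0))) t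

gap : ℕ → ℕ → ℕ → ℕ → ℕ
gap x y i j = ∣ fold x step₀ i - fold y step₀ j ∣

gapᴿ : ∀ {x y i j} → Recursive x → Recursive y → Recursive i → Recursive j →
  Recursive (λ o n → gap (x o n) (y o n) (i o n) (j o n))
gapᴿ x y i j = distanceᴿ (step₀-foldᴿ x i) (step₀-foldᴿ y j)

-- The program searches for a coded pair of meeting times, at which `gap` vanishes.
~-computablyEnumerable : ComputablyEnumerable _~_
~-computablyEnumerable = μ (code₂ gap₂) , λ x y → mk⇔ (meet x y) (sound x y)
  where
  gap₂ : Recursive₂ (λ _ z w → gap (π₁ z) (π₂ z) (π₁ w) (π₂ w))
  gap₂ = curried (gapᴿ (π₁ᴿ ∘ᴿ π₁ᴿ) (π₂ᴿ ∘ᴿ π₁ᴿ) (π₁ᴿ ∘ᴿ π₂ᴿ) (π₂ᴿ ∘ᴿ π₂ᴿ))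

  meet : ∀ x y → x ~ y → ∃[ v ] ⟦ μ (code₂ gap₂) ⟧ 0ω (pair x y) v
  meet x y (i , j , e) = search gap₂ {0ω} {pair x y} ⟨ i , j ⟩ gap≡0
    where
    gap≡0 : gap (π₁ (pair x y)) (π₂ (pair x y)) (π₁ ⟨ i , j ⟩) (π₂ ⟨ i , j ⟩) ≡ 0
    gap≡0 rewrite unpair-pair x y | π₁-⟨⟩ i j | π₂-⟨⟩ i j = m≡n⇒∣m-n∣≡0 e

  sound : ∀ x y → ∃[ v ] ⟦ μ (code₂ gap₂) ⟧ 0ω (pair x y) v → x ~ y
  sound x y (v , h) = π₁ v , π₂ v , subst₂ (λ x y → fold x step₀ (π₁ v) ≡ fold y step₀ (π₂ v))
    (cong proj₁ (unpair-pair x y)) (cong proj₂ (unpair-pair x y))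
    (∣m-n∣≡0⇒m≡n (search-sound gap₂ {0ω} {pair x y} h))

module Ideal {I : ℕ → Set} (ideal : IsIdeal _~_ I) where
  open IsIdeal ideal public

  -- Two members lie below a common one, and `~` is symmetric.
  ∈⇒~ : ∀ {x y} → I x → I y → x ~ y
  ∈⇒~ Ix Iy = let _ , _ , x~z , y~z = directed Ix Iy in ~-trans x~z (~-sym y~z)

-- ⟨ m , ⟨ i , j ⟩ ⟩ claims that m after i steps and n after j steps coincide.
classSequence : ℕ → Sequence
classSequence n w = ifz (gap (π₁ w) n (π₁ (π₂ w)) (π₂ (π₂ w))) (π₁ w) n

classSequenceᴿ : Recursive₂ (λ _ → classSequence)
classSequenceᴿ = curried
  (ifzᴿ (gapᴿ (π₁ᴿ ∘ᴿ π₂ᴿ) π₁ᴿ (π₁ᴿ ∘ᴿ π₂ᴿ ∘ᴿ π₂ᴿ) (π₂ᴿ ∘ᴿ π₂ᴿ ∘ᴿ π₂ᴿ)) (π₁ᴿ ∘ᴿ π₂ᴿ) π₁ᴿ)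

classSequence-~ : ∀ n w → classSequence n w ~ n
classSequence-~ n w with gap (π₁ w) n (π₁ (π₂ w)) (π₂ (π₂ w)) in e
... | zero  = π₁ (π₂ w) , π₂ (π₂ w) , ∣m-n∣≡0⇒m≡n e
-- A false claim yields the default `n`, which lies in its own class.
... | suc _ = ~-refl

classSequence-complete : ∀ {m n} → m ~ n → ∃[ w ] classSequence n w ≡ m
classSequence-complete {m} {n} (i , j , e) = ⟨ m , ⟨ i , j ⟩ ⟩ , claim
  where
  claim : classSequence n ⟨ m , ⟨ i , j ⟩ ⟩ ≡ m
  claim rewrite π₁-⟨⟩ m ⟨ i , j ⟩ | π₂-⟨⟩ m ⟨ i , j ⟩ | π₁-⟨⟩ i j | π₂-⟨⟩ i j
              | m≡n⇒∣m-n∣≡0 e = refl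

-- The space of equivalence classes

X : RepresentedSpace (lsuc 0ℓ) 0ℓ 0ℓ
X = 𝐈 _~_

open RepresentedSpace X using (_≈_)

class : ℕ → RepresentedSpace.Carrier X
class n = ((_~ n) , ideal) , classSequence n , classSequence-name
  where
  ideal : IsIdeal _~_ (_~ n)
  ideal = record
    { nonempty   = n , ~-refl
    ; downClosed = ~-trans
    ; directed   = λ x~n y~n → n , ~-refl , x~n , y~n
    }

  classSequence-name : ∀ m → (m ~ n) ⇔ (∃[ w ] classSequence n w ≡ m)
  classSequence-name m =
    mk⇔ classSequence-complete (λ (w , e) → subst (_~ n) e (classSequence-~ n w))

class-names : ∀ n → X ∋ classSequence n ⊩ class n
class-names n = proj₂ (proj₂ (class n))

class-cong : ∀ {m n} → m ~ n → class m ≈ class n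
class-cong m~n k = mk⇔ (λ h → ~-trans h m~n) (λ h → ~-trans h (~-sym m~n))

-- Any member represents the ideal: `∈⇒~` gives one inclusion, downward closure the other.
class-surjective : ∀ x → ∃[ n ] x ≈ class n
class-surjective ((I , ideal) , _) =
  let n , In = nonempty
  in n , λ m → mk⇔ (λ Im → ∈⇒~ Im In) (λ m~n → downClosed m~n In)
  where open Ideal ideal

X-infinite : Infinite X
X-infinite = record
  { to        = λ n → class ⟨ halt , n ⟩
  ; cong      = λ { refl → Setoid.refl (RepresentedSpace.points X) {class _} }
  ; injective = λ {m} {n} e → ⟨⟩-injectiveʳ
      (halted-~ (running-halt m) (running-halt n) (Equivalence.to (e ⟨ halt , m ⟩) ~-refl))
  }

X-precomputablyQuasiPolish : PrecomputablyQuasiPolish X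
X-precomputablyQuasiPolish =
  _~_ , ~-trans , ~-computablyEnumerable , Identity.inverse (RepresentedSpace.points X)
  -- `query` copies its oracle, realising the identity.
  , (query , λ x p h → p , (λ _ → refl) , h)
  , (query , λ x p h → p , (λ _ → refl) , h)

-- Semidecidable sets

-- `w` turns names of `y` into names of the truth value `P₀ y`. A realiser finds the name of its
-- argument at the odd positions of its oracle, hence `w (odds o)`.
module _ {c ℓ r a} (Y : RepresentedSpace c ℓ r) {P : RepresentedSpace.Carrier Y → Set a}
         {P₀ : RepresentedSpace.Carrier Y → Set} (P₀⇔P : ∀ y → P₀ y ⇔ P y)
         {w : Sequence → Sequence} (wᴿ : Recursive (λ o → w (odds o)))
         (semidecides : ∀ {p y} → Y ∋ p ⊩ y → P₀ y ⇔ (∃[ k ] w p k ≢ 0)) where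

  private
    module Y = RepresentedSpace Y

  semidecidable⇒open : ComputablyOpen Y P
  semidecidable⇒open = (χ , p , names) , (p , computable , names) , P₀⇔P
    where
    χ : Map Y 𝕊
    χ = record
      { to   = λ y → P₀ y , w (proj₁ (Y.surjective y)) , semidecides (proj₂ (Y.surjective y))
      ; cong = λ {y} {y′} y≈y′ → let q , h = Y.surjective y in
          ⇔.trans (semidecides h) (⇔.sym (semidecides (Y.⊩-resp (λ _ → refl) y≈y′ h)))
      }

    p : Sequence
    p _ = encode (code wᴿ)

    computable : ComputableSequence p
    computable = code const , computes const 0ω
      where const = constᴿ (encode (code wᴿ))

    names : Codes Y 𝕊 p χ
    names = code wᴿ , refl , λ y q h →
      w (odds (interleave (p ∘ suc) q)) , computes wᴿ (interleave (p ∘ suc) q) , semidecides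
      (Y.⊩-resp (λ k → sym (odds-interleave (p ∘ suc) q k)) (Setoid.refl Y.points) h)

-- Discreteness

X-discrete : ComputablyDiscrete X
X-discrete = semidecidable⇒open (X ×ᴿ X) (λ _ → ⇔.refl) {w} wᴿ
  (λ {p} {xy} → semidecides {p} {xy})
  where
  w : Sequence → Sequence
  -- Nonzero exactly when the two entries agree; `k` ranges over all pairs of positions.
  w p k = 1 ∸ ∣ evens p (π₁ k) - odds p (π₂ k) ∣

  wᴿ : Recursive (λ o → w (odds o))
  wᴿ = ∸ᴿ (constᴿ 1) (distanceᴿ
    -- Entry `i` of the first name sits at oracle position 4i + 1, entry `j` of the second at 4j +
    -- 3.
    (queryᴿ (sucᴿ (doubleᴿ (doubleᴿ π₁ᴿ))))
    (queryᴿ (sucᴿ (doubleᴿ (sucᴿ (doubleᴿ π₂ᴿ))))))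

  w-equal : ∀ p i j → evens p i ≡ odds p j → w p ⟨ i , j ⟩ ≢ 0
  w-equal p i j e rewrite π₁-⟨⟩ i j | π₂-⟨⟩ i j | m≡n⇒∣m-n∣≡0 e = λ ()

  equal-w : ∀ m n → 1 ∸ ∣ m - n ∣ ≢ 0 → m ≡ n
  equal-w m n h with ∣ m - n ∣ in e
  ... | zero        = ∣m-n∣≡0⇒m≡n e
  ... | suc zero    = contradiction refl h
  ... | suc (suc _) = contradiction refl h

  semidecides : ∀ {p xy} → (X ×ᴿ X) ∋ p ⊩ xy →
    (proj₁ xy ≈ proj₂ xy) ⇔ (∃[ k ] w p k ≢ 0)
  semidecides {p} {((I , I-ideal) , _) , ((J , J-ideal) , _)} (hI , hJ) = mk⇔ meet equal
    where
    module I = Ideal I-ideal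
    module J = Ideal J-ideal

    meet : (∀ n → I n ⇔ J n) → ∃[ k ] w p k ≢ 0
    meet I≈J =
      let a , Ia = I.nonempty
          i , ei = Equivalence.to (hI a) Ia
          j , ej = Equivalence.to (hJ a) (Equivalence.to (I≈J a) Ia)
      in ⟨ i , j ⟩ , w-equal p i j (trans ei (sym ej))

    equal : ∃[ k ] w p k ≢ 0 → ∀ n → I n ⇔ J n
    equal (k , h) n = mk⇔
      (λ In → J.downClosed (I.∈⇒~ In Ia) Ja)
      (λ Jn → I.downClosed (J.∈⇒~ Jn Ja) Ia)
      where
      a = evens p (π₁ k)
      Ia = Equivalence.from (hI a) (π₁ k , refl)
      Ja = Equivalence.from (hJ a) (π₂ k , sym (equal-w a (odds p (π₂ k)) h))

-- Evaluation by the machine, and overtness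

evalᴿ : ∀ {q c n t} → Recursive₂ q → Recursive c → Recursive n → Recursive t →
  Recursive (λ o z → fold ⟨ ⟨ c o z , halt ⟩ , n o z ⟩ (step (q o z)) (t o z))
evalᴿ {q} qᴿ c n t =
  foldᴿ (λ o z → step (q o z)) (pairᴿ (pairᴿ c (constᴿ halt)) n) (stepᴿ qᴿ) t

eval-halts : ∀ c {q n v} → ⟦ c ⟧ q n v →
  ∃[ t ] fold ⟨ ⟨ encode c , halt ⟩ , n ⟩ (step q) t ≡ ⟨ halt , v ⟩
eval-halts c {q} {n} {v} h with simulates c halt h
... | after t e = t , subst (λ x → fold ⟨ ⟨ x , halt ⟩ , n ⟩ (step q) t ≡ _) (⌜⌝≡encode c) e

-- The halted state seen at time `t` must be the one that the simulation reaches.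
eval-value : ∀ c {q n v} → ⟦ c ⟧ q n v → ∀ t →
  running (fold ⟨ ⟨ encode c , halt ⟩ , n ⟩ (step q) t) ≡ 0 →
  value (fold ⟨ ⟨ encode c , halt ⟩ , n ⟩ (step q) t) ≡ v
eval-value c {q} {n} {v} h t stopped with eval-halts c h
... | u , e = trans
  (cong value (trans (halted-unique q _ t u stopped (trans (cong running e) (running-halt v))) e))
  (π₂-⟨⟩ halt v)

X-overt : ComputablyOvert X
X-overt = semidecidable⇒open (𝒪 X)
  -- `Nonempty` quantifies over points and is too large to be a truth value of `𝕊`; representatives
  -- in `ℕ` replace the points.
  {P₀ = λ U → ∃[ n ] Contains X U (class n)} nonempty {w} wᴿ
  (λ {p} {U} → semidecides {p} {U})
  where
  nonempty : ∀ U → (∃[ n ] Contains X U (class n)) ⇔ Nonempty X U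
  nonempty U@(χ , _) = mk⇔ (λ (n , h) → class n , h) λ (x , h) →
    let n , x≈n = class-surjective x
    in n , Equivalence.to (Func.cong χ {x} {class n} x≈n) h

  state : Sequence → ℕ → ℕ
  -- `k` is read as `⟨ ⟨ n , i ⟩ , t ⟩`: run the program for `t` steps on input `i`, with the
  -- standard name of `class n`.
  state p k = fold ⟨ ⟨ p 0 , halt ⟩ , π₂ (π₁ k) ⟩
    (step (interleave (p ∘ suc) (classSequence (π₁ (π₁ k))))) (π₂ k)

  w : Sequence → Sequence
  -- An unfinished run contributes 0 and thus signals nothing.
  w p k = ifz (running (state p k)) (value (state p k)) 0

  stateᴿ : Recursive (λ o → state (odds o))
  stateᴿ = evalᴿ
    (interleaveᴿ (curried (queryᴿ (sucᴿ (doubleᴿ (sucᴿ π₂ᴿ)))))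
                 (curried (app₂ classSequenceᴿ (π₁ᴿ ∘ᴿ π₁ᴿ ∘ᴿ π₁ᴿ) π₂ᴿ)))
    -- Oracle position 1 holds `p 0`, the index of the program.
    (queryᴿ (constᴿ 1)) (π₂ᴿ ∘ᴿ π₁ᴿ) π₂ᴿ

  wᴿ : Recursive (λ o → w (odds o))
  wᴿ = ifzᴿ (runningᴿ stateᴿ) (π₂ᴿ ∘ᴿ stateᴿ) (constᴿ 0)

  semidecides : ∀ {p U} → 𝒪 X ∋ p ⊩ U →
    (∃[ n ] Contains X U (class n)) ⇔ (∃[ k ] w p k ≢ 0)
  semidecides {p} {U} (c , p0 , realises) = mk⇔ hit member
    where
    oracle : ℕ → Sequence
    oracle n = interleave (p ∘ suc) (classSequence n)

    hit : ∃[ n ] Contains X U (class n) → ∃[ k ] w p k ≢ 0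
    hit (n , h) =
      let y , run , y⊩ = realises (class n) (classSequence n) (class-names n)
          k , yk≢0     = Equivalence.to y⊩ h
          t , e        = eval-halts c (run k)
      in ⟨ ⟨ n , k ⟩ , t ⟩ , λ w≡0 → yk≢0 (trans (sym (w-value n k t e)) w≡0)
      where
      w-value : ∀ n k t {v} →
        fold ⟨ ⟨ encode c , halt ⟩ , k ⟩ (step (oracle n)) t ≡ ⟨ halt , v ⟩ →
        w p ⟨ ⟨ n , k ⟩ , t ⟩ ≡ v
      w-value n k t {v} e
        rewrite π₁-⟨⟩ ⟨ n , k ⟩ t | π₂-⟨⟩ ⟨ n , k ⟩ t | π₁-⟨⟩ n k | π₂-⟨⟩ n k | p0 | e
              | running-halt v
        = π₂-⟨⟩ halt v

    member : ∃[ k ] w p k ≢ 0 → ∃[ n ] Contains X U (class n)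
    member (k , wk≢0) =
      let n            = π₁ (π₁ k)
          y , run , y⊩ = realises (class n) (classSequence n) (class-names n)
      in n , Equivalence.from y⊩ (π₂ (π₁ k) , λ y≡0 → wk≢0 (w-zero (run _) y≡0))
      where
      w-zero : ∀ {v} → ⟦ c ⟧ (oracle (π₁ (π₁ k))) (π₂ (π₁ k)) v → v ≡ 0 → w p k ≡ 0
      w-zero h v≡0 rewrite p0
        with running (fold ⟨ ⟨ encode c , halt ⟩ , π₂ (π₁ k) ⟩ (step (oracle (π₁ (π₁ k)))) (π₂ k))
          in stopped
      ... | zero  = trans (eval-value c h (π₂ k) stopped) v≡0
      ... | suc _ = refl

-- Self-application, and constancy of computable maps to ℕ

self : ℕ → ℕ
self c = ⟨ ⟨ c , jump ⟩ , c ⟩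

-- Modulo `~`, the total function `self` extends the partial map applying a program to its own code,
-- as for precomplete numberings. The `jump` frame makes the result the next state.
self-~ : ∀ c {v} → ⟦ c ⟧ 0ω (encode c) v → self (encode c) ~ v
self-~ c {v} h = ↝⇒~ (subst (λ x → 0ω ⊢ ⟨ ⟨ x , jump ⟩ , encode c ⟩ ↝ v) (⌜⌝≡encode c)
  (simulates c jump h ⨾ frame 13 0 0 v refl))

X-constant : (f : Map X ℕᴿ) → Computable X ℕᴿ f → Constant X ℕᴿ f
X-constant f (d , realises) x y =
  let a , x≈a = class-surjective x
      b , y≈b = class-surjective y
  in trans (Func.cong f {x} {class a} x≈a)
           (trans (constant a b) (sym (Func.cong f {y} {class b} y≈b)))
  where
  g : ℕ → ℕ
  g n = Func.to f (class n)

  module _ (a b : ℕ) where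

    state : ℕ → ℕ → ℕ
    -- The input is 0 because a name of a number carries it at position 0.
    state c t = fold ⟨ ⟨ encode d , halt ⟩ , 0 ⟩ (step (classSequence (self c))) t

    stateᴿ : Recursive (λ _ z → state (π₁ z) (π₂ z))
    stateᴿ = evalᴿ
      (curried (app₂ classSequenceᴿ (pairᴿ (pairᴿ c (constᴿ jump)) c) π₂ᴿ))
      (constᴿ (encode d)) (constᴿ 0) π₂ᴿ
      where c = π₁ᴿ ∘ᴿ π₁ᴿ

    runningᴿ₂ : Recursive₂ (λ _ c t → running (state c t))
    runningᴿ₂ = curried (runningᴿ stateᴿ)

    switch : ℕ → ℕ
    switch v = ifz (∣ v - g b ∣) a b

    switchᴿ₂ : Recursive₂ (λ _ c t → switch (value (state c t)))
    switchᴿ₂ = curried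
      (ifzᴿ (distanceᴿ (π₂ᴿ ∘ᴿ stateᴿ) (constᴿ (g b))) (constᴿ a) (constᴿ b))

    diagonal : Code
    diagonal = comp (code₂ switchᴿ₂) (pairing (code idᴿ) (μ (code₂ runningᴿ₂)))

    -- As `f` is total, `d` halts on the name of `class (self c)`, so the search for a halting time
    -- succeeds for every number `c`.
    diagonal-computes : ∀ c → ⟦ diagonal ⟧ 0ω c (switch (g (self c)))
    diagonal-computes c =
      let n            = self c
          y , run , y0 = realises (class n) (classSequence n) (class-names n)
          u , halts    = eval-halts d (run 0)
          t , found    = search runningᴿ₂ {0ω} {c} u
                           (trans (cong running halts) (running-halt (y 0)))
          stopped      = search-sound runningᴿ₂ {0ω} {c} found
      in pair c t , (c , t , computes idᴿ 0ω c , found , refl)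
       , subst₂ (⟦ code₂ switchᴿ₂ ⟧ 0ω) (⟨⟩≡pair c t)
           (cong switch (trans (eval-value d (run 0) t stopped) y0))
           (computes₂ switchᴿ₂ 0ω c t)

    constant : g a ≡ g b
    constant = decide ∣ g n - g b ∣ refl
      where
      n = self (encode diagonal)

      g-switch : g n ≡ g (switch (g n))
      g-switch = Func.cong f {class n} {class (switch (g n))}
        (class-cong (self-~ diagonal (diagonal-computes (encode diagonal))))

      g-ifz : ∀ {k} → ∣ g n - g b ∣ ≡ k → g n ≡ g (ifz k a b)
      g-ifz e = trans g-switch (cong (λ k → g (ifz k a b)) e)

      decide : ∀ k → ∣ g n - g b ∣ ≡ k → g a ≡ g b
      -- Here the switch chose `a`, so `g n` is both `g a` and `g b`.
      decide zero    e = trans (sym (g-ifz e)) (∣m-n∣≡0⇒m≡n e)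
      -- Here it chose `b`, which forces `g n ≡ g b` against the assumption.
      decide (suc k) e = contradiction (trans (sym e) (m≡n⇒∣m-n∣≡0 (g-ifz e))) λ ()

mainTheorem3 : Σ (RepresentedSpace (lsuc 0ℓ) 0ℓ 0ℓ) λ X →
    Infinite X
    × ComputablyDiscrete X
    × ComputablyQuasiPolish X
    × ((f : Map X ℕᴿ) → Computable X ℕᴿ f → Constant X ℕᴿ f)
mainTheorem3 =
  X , X-infinite , X-discrete , (X-precomputablyQuasiPolish , X-overt) , X-constant
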